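{- For every positive integer $a$ we have $$\sum_{k=0}^{3^a-1}(-2)^k\binom{2k}{k}\equiv 3^a\pmod{3^{a+1}},$$ $$\sum_{k=0}^{3^a-1}(-5)^k\binom{2k}{k}\equiv-3^a\pmod{3^{a+1}},$$ $$\sum_{k=0}^{7^a-1}(-5)^k\binom{2k}{k}\equiv 7^a\pmod{7^{a+1}}.$$ -}

module Defs where

open import Data.Fin.Base using (toℕ)
open import Data.Integer.Base using (ℤ; +_; _*_; _-_; _^_)
open import Data.Integer.Divisibility.Signed using (_∣_)
open import Data.Integer.Properties using (+-*-semiring)
open import Data.Nat.Base as ℕ using (ℕ)
open import Data.Nat.Combinatorics using (_C_)
open import Algebra.Properties.Semiring.Sum +-*-semiring using (sum-syntax)

infix 4 _≡_[mod_]

_≡_[mod_] : ℤ → ℤ → ℤ → Set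
x ≡ y [mod m ] = m ∣ x - y

centralBinomialSum : ℤ → ℕ → ℤ
centralBinomialSum m n =
  ∑[ k < n ] (m ^ toℕ k * + ((2 ℕ.* toℕ k) C toℕ k))

-- Put D = 1 − 4x and T_j(n) = Σ_{k<n} 4^(n−1−k) C(k,j) C(2k,k).  Expanding
-- (4x)^k = (1 − D)^k gives 4^(n−1) S(n) = Σ_j (−D)^j T_j(n) for the sum S(n) in question,
-- and T_j has the closed form (2j+1) T_j(n) = n C(2n−1,n) C(n−1,j).  For n = p^a with p ∣ D,
-- the terms with j ≥ 2 vanish modulo p^(a+1) because 2j+1 < p^j, while C(2n−1,n) ≡ 1 (mod p).
-- When −D = 3z, the terms j = 0, 1 contribute n + z n (n−1) ≡ n (1 − z), and
-- 4^n ≡ 4 (mod p) yields S(p^a) ≡ p^a (1 − z) (mod p^(a+1)).  The three congruences are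
-- (p, x, z) = (3, −2, −3), (3, −5, −7), (7, −5, −7).
module Submission where

open import Defs
open import Data.Integer.Base using (+_; -_)
open import Data.Nat.Base using (ℕ; NonZero; suc; _^_)
open import Data.Product.Base using (_×_)

open import Data.Fin.Base using (Fin; toℕ; fromℕ; inject₁)
open import Data.Fin.Properties using (toℕ-fromℕ; toℕ-inject₁)
open import Data.Integer.Base as ℤ using (ℤ)
import Data.Integer.Divisibility.Signed as ℤ∣
import Data.Integer.Properties as ℤ
import Data.Integer.Tactic.RingSolver as ℤ-Solver
open import Algebra.Properties.Semiring.Sum ℤ.+-*-semiring
  using (sum-syntax; sum-cong-≗; sum-replicate-zero; sum-init-last; ∑-distrib-+; *-distribˡ-sum)
open import Data.Nat.Base as ℕ using (zero; _≤_; _<_; s≤s)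
open import Data.Nat.Combinatorics
  using (_C_; nCn≡1; nC1≡n; nCk≡nC[n∸k]; nCk+nC[k+1]≡[n+1]C[k+1])
open import Data.Nat.Divisibility
  using (_∣_; divides; quotient; _∣?_; 1∣_; ∣-trans; ∣⇒≤; m∣m*n; ∣n⇒∣m*n; *-monoʳ-∣; *-cancelˡ-∣)
import Data.Nat.Properties as ℕ
import Data.Nat.Tactic.RingSolver as ℕ-Solver
open import Data.Nat.Primality using (Prime; prime?; euclidsLemma; prime⇒nonZero)
open import Data.Product.Base using (∃-syntax; _,_)
open import Data.Sum.Base as Sum using (inj₁; inj₂)
open import Relation.Binary.PropositionalEquality
  using (_≡_; refl; sym; trans; cong; cong₂; subst; subst₂; module ≡-Reasoning)
open import Relation.Nullary using (¬_; yes; no; contradiction)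
open import Relation.Nullary.Decidable using (from-yes)

-- Binomial identities and the closed form of T_j.

private
  pascal : ∀ n k → suc n C suc k ≡ n C k ℕ.+ n C suc k
  pascal n k = sym (nCk+nC[k+1]≡[n+1]C[k+1] n k)

module _ where
  open Data.Nat.Base using (_+_; _*_)
  open ≡-Reasoning

  [1+k]*[1+n]C[1+k]≡[1+n]*nCk : ∀ n k → suc k * (suc n C suc k) ≡ suc n * (n C k)
  [1+k]*[1+n]C[1+k]≡[1+n]*nCk zero    zero    = refl
  [1+k]*[1+n]C[1+k]≡[1+n]*nCk zero    (suc k) = ℕ.*-zeroʳ (suc (suc k))
  [1+k]*[1+n]C[1+k]≡[1+n]*nCk (suc n) zero    = begin
    1 * (suc (suc n) C 1)  ≡⟨ ℕ.*-identityˡ _ ⟩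
    suc (suc n) C 1        ≡⟨ nC1≡n (suc (suc n)) ⟩
    suc (suc n)            ≡⟨ ℕ.*-identityʳ _ ⟨
    suc (suc n) * 1        ∎
  [1+k]*[1+n]C[1+k]≡[1+n]*nCk (suc n) (suc k) = begin
    suc (suc k) * (suc (suc n) C suc (suc k))
      ≡⟨ cong (suc (suc k) *_) (pascal (suc n) (suc k)) ⟩
    suc (suc k) * (A + B)
      ≡⟨ regroup k A B ⟩
    suc k * A + A + suc (suc k) * B
      ≡⟨ cong₂ (λ u v → u + A + v) ([1+k]*[1+n]C[1+k]≡[1+n]*nCk n k)
                                   ([1+k]*[1+n]C[1+k]≡[1+n]*nCk n (suc k)) ⟩
    suc n * (n C k) + A + suc n * (n C suc k)
      ≡⟨ collect n (n C k) A (n C suc k) ⟩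
    suc n * (n C k + n C suc k) + A
      ≡⟨ cong (λ u → suc n * u + A) (pascal n k) ⟨
    suc n * A + A
      ≡⟨ ℕ.+-comm (suc n * A) A ⟩
    suc (suc n) * A ∎
    where
    A = suc n C suc k
    B = suc n C suc (suc k)
    regroup : ∀ k A B → suc (suc k) * (A + B) ≡ suc k * A + A + suc (suc k) * B
    regroup = ℕ-Solver.solve-∀
    collect : ∀ n u A v → suc n * u + A + suc n * v ≡ suc n * (u + v) + A
    collect = ℕ-Solver.solve-∀

  -- Subtraction-free form of (n+1-k) C(n+1,k) = (n+1) C(n,k), so no assumption `k ≤ n` arises.
  k*[1+n]Ck+[1+n]*nCk≡[1+n]*[1+n]Ck : ∀ n k →
    k * (suc n C k) + suc n * (n C k) ≡ suc n * (suc n C k)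
  k*[1+n]Ck+[1+n]*nCk≡[1+n]*[1+n]Ck n zero    = refl
  k*[1+n]Ck+[1+n]*nCk≡[1+n]*[1+n]Ck n (suc k) = begin
    suc k * (suc n C suc k) + suc n * (n C suc k)
      ≡⟨ cong (_+ suc n * (n C suc k)) ([1+k]*[1+n]C[1+k]≡[1+n]*nCk n k) ⟩
    suc n * (n C k) + suc n * (n C suc k)
      ≡⟨ ℕ.*-distribˡ-+ (suc n) (n C k) (n C suc k) ⟨
    suc n * (n C k + n C suc k)
      ≡⟨ cong (suc n *_) (pascal n k) ⟨
    suc n * (suc n C suc k) ∎

  [1+2n]Cn≡[1+2n]C[1+n] : ∀ n → suc (2 * n) C n ≡ suc (2 * n) C suc n
  [1+2n]Cn≡[1+2n]C[1+n] n = begin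
    suc (2 * n) C n                          ≡⟨ cong (_C n) 1+2n≡n+[1+n] ⟩
    (n + suc n) C n                          ≡⟨ nCk≡nC[n∸k] (ℕ.m≤m+n n (suc n)) ⟩
    (n + suc n) C (n + suc n ℕ.∸ n)  ≡⟨ cong ((n + suc n) C_) (ℕ.m+n∸m≡n n (suc n)) ⟩
    (n + suc n) C suc n                      ≡⟨ cong (_C suc n) 1+2n≡n+[1+n] ⟨
    suc (2 * n) C suc n                      ∎
    where
    1+2n≡n+[1+n] : suc (2 * n) ≡ n + suc n
    1+2n≡n+[1+n] = lemma n where
      lemma : ∀ n → suc (2 * n) ≡ n + suc n
      lemma = ℕ-Solver.solve-∀

  -- Pascal's rule splits the central coefficient into the two middle entries of an odd row, which
  -- agree by symmetry.
  [2+2n]C[1+n]≡2*[1+2n]C[1+n] : ∀ n →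
    (2 * suc n) C suc n ≡ 2 * (suc (2 * n) C suc n)
  [2+2n]C[1+n]≡2*[1+2n]C[1+n] n = begin
    (2 * suc n) C suc n                          ≡⟨ cong (_C suc n) (ℕ.*-suc 2 n) ⟩
    suc (suc (2 * n)) C suc n                    ≡⟨ pascal (suc (2 * n)) n ⟩
    suc (2 * n) C n + suc (2 * n) C suc n        ≡⟨ cong (_+ d) ([1+2n]Cn≡[1+2n]C[1+n] n) ⟩
    d + d                                        ≡⟨ cong (λ u → d + u) (ℕ.+-identityʳ d) ⟨
    2 * d                                        ∎
    where d = suc (2 * n) C suc n

  -- Σ_{k<n} 4^(n-1-k) C(k,j) C(2k,k)
  scaledSum : ℕ → ℕ → ℕ
  scaledSum j zero    = 0
  scaledSum j (suc n) = 4 * scaledSum j n + (n C j) * ((2 * n) C n)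

  -- Induction on the length. Writing the length as `suc n` turns C(2N-1,N) into C(2n+1,n+1) without
  -- truncated subtraction; the old closed form and the new term are both multiples of this `d`.
  [1+2j]*scaledSum : ∀ j n →
    suc (2 * j) * scaledSum j (suc n) ≡ suc n * (suc (2 * n) C suc n) * (n C j)
  [1+2j]*scaledSum zero    zero    = refl
  [1+2j]*scaledSum (suc j) zero    = ℕ.*-zeroʳ (suc (2 * suc j))
  [1+2j]*scaledSum j       (suc n) = begin
    suc (2 * j) * (4 * scaledSum j (suc n) + C′ * ((2 * suc n) C suc n))
      ≡⟨ cong (λ u → suc (2 * j) * (4 * scaledSum j (suc n) + C′ * u)) ([2+2n]C[1+n]≡2*[1+2n]C[1+n] n) ⟩
    suc (2 * j) * (4 * scaledSum j (suc n) + C′ * (2 * d))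
      ≡⟨ expand j (scaledSum j (suc n)) C′ d ⟩
    4 * (suc (2 * j) * scaledSum j (suc n)) + suc (2 * j) * (C′ * (2 * d))
      ≡⟨ cong (λ u → 4 * u + suc (2 * j) * (C′ * (2 * d))) ([1+2j]*scaledSum j n) ⟩
    4 * (suc n * d * (n C j)) + suc (2 * j) * (C′ * (2 * d))
      ≡⟨ collect j (suc n) d (n C j) C′ ⟩
    4 * d * (j * C′ + suc n * (n C j)) + 2 * d * C′
      ≡⟨ cong (λ u → 4 * d * u + 2 * d * C′) (k*[1+n]Ck+[1+n]*nCk≡[1+n]*[1+n]Ck n j) ⟩
    4 * d * (suc n * C′) + 2 * d * C′
      ≡⟨ factor n d C′ ⟩
    suc (2 * suc n) * (2 * d) * C′
      ≡⟨ cong (λ u → suc (2 * suc n) * u * C′) ([2+2n]C[1+n]≡2*[1+2n]C[1+n] n) ⟨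
    suc (2 * suc n) * ((2 * suc n) C suc n) * C′
      -- Absorption in row 2n+3 trades the factor 2n+3 for n+2 and so reaches the next value of `d`.
      ≡⟨ cong (_* C′) ([1+k]*[1+n]C[1+k]≡[1+n]*nCk (2 * suc n) (suc n)) ⟨
    suc (suc n) * (suc (2 * suc n) C suc (suc n)) * C′ ∎
    where
    C′ = suc n C j
    d  = suc (2 * n) C suc n
    expand : ∀ j t C′ d →
      suc (2 * j) * (4 * t + C′ * (2 * d)) ≡ 4 * (suc (2 * j) * t) + suc (2 * j) * (C′ * (2 * d))
    expand = ℕ-Solver.solve-∀
    collect : ∀ j N d c C′ →
      4 * (N * d * c) + suc (2 * j) * (C′ * (2 * d)) ≡ 4 * d * (j * C′ + N * c) + 2 * d * C′
    collect = ℕ-Solver.solve-∀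
    factor : ∀ n d C′ → 4 * d * (suc n * C′) + 2 * d * C′ ≡ suc (2 * suc n) * (2 * d) * C′
    factor = ℕ-Solver.solve-∀

  -- Equality holds at j = 0 and j = 1, hence the offset 2: those two terms of the expansion are
  -- evaluated explicitly.
  1+2j<3^j : ∀ i → suc (2 * (2 + i)) < 3 ^ (2 + i)
  1+2j<3^j zero    = from-yes (5 ℕ.<? 9)
  1+2j<3^j (suc i) = ℕ.≤-trans (subst (suc (suc (2 * (3 + i))) ≤_) (lemma i) (ℕ.m≤m+n _ (4 * i + 10)))
                               (ℕ.*-monoʳ-≤ 3 (1+2j<3^j i))
    where
    lemma : ∀ i → suc (suc (2 * (3 + i))) + (4 * i + 10) ≡ 3 * suc (suc (2 * (2 + i)))
    lemma = ℕ-Solver.solve-∀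

  -- Divisibility by prime powers, and binomial coefficients modulo p.

  module _ {p} (p-prime : Prime p) where
    private instance
      p≢0 : NonZero p
      p≢0 = prime⇒nonZero p-prime

    prime-power-cancelˡ-∣ : ∀ a {m n} → ¬ p ∣ m → p ^ a ∣ m * n → p ^ a ∣ n
    prime-power-cancelˡ-∣ zero    p∤m _ = 1∣ _
    prime-power-cancelˡ-∣ (suc a) {m} {n} p∤m p^[1+a]∣mn
      with euclidsLemma m n p-prime (∣-trans (m∣m*n (p ^ a)) p^[1+a]∣mn)
    ... | inj₁ p∣m = contradiction p∣m p∤m
    ... | inj₂ (divides q refl) =
      subst (p ^ suc a ∣_) (ℕ.*-comm p q) (*-monoʳ-∣ p
        (prime-power-cancelˡ-∣ a p∤m (*-cancelˡ-∣ p (subst (p ^ suc a ∣_) (lemma m q p) p^[1+a]∣mn))))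
      where
      lemma : ∀ m q p → m * (q * p) ≡ p * (m * q)
      lemma = ℕ-Solver.solve-∀

    -- m < p^j bounds the p-adic valuation of m by j - 1.
    p^a∣m*n⇒p^[1+a]∣p^j*n : ∀ a j {m n} → .{{NonZero m}} → m < p ^ j →
      p ^ a ∣ m * n → p ^ suc a ∣ p ^ j * n
    p^a∣m*n⇒p^[1+a]∣p^j*n a zero {m = suc _} (s≤s ()) _
    p^a∣m*n⇒p^[1+a]∣p^j*n a (suc j) {m} {n} m<p^[1+j] p^a∣mn with p ∣? m
    ... | no p∤m = subst (p ^ suc a ∣_) (sym (ℕ.*-assoc p (p ^ j) n))
                     (*-monoʳ-∣ p (∣n⇒∣m*n (p ^ j) (prime-power-cancelˡ-∣ a p∤m p^a∣mn)))
    -- One factor p moves from m = q p over to n, and m < p^(j+1) becomes q < p^j, so the induction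
    -- on j applies.
    ... | yes (divides q@(suc _) refl) =
      subst (p ^ suc a ∣_) (lemma (p ^ j) p n)
        (p^a∣m*n⇒p^[1+a]∣p^j*n a j
          (ℕ.*-cancelˡ-< p q (p ^ j) (subst (_< p * p ^ j) (ℕ.*-comm q p) m<p^[1+j]))
          (subst (p ^ a ∣_) (ℕ.*-assoc q p n) p^a∣mn))
      where
      lemma : ∀ x p n → x * (p * n) ≡ p * x * n
      lemma = ℕ-Solver.solve-∀

    -- By absorption p^a divides (k+1) C(p^a,k+1). Since k+1 < p^a, the valuation lemma with j = a
    -- gives p^(a+1) dividing p^a C(p^a,k+1), and p^a cancels.
    p∣p^aCk : ∀ a k → suc k < p ^ a → p ∣ (p ^ a) C suc k
    p∣p^aCk a k k<N with p ^ a in eq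
    ... | suc n = *-cancelˡ-∣ (p ^ a) {{ℕ.m^n≢0 p a}}
      (subst (_∣ p ^ a * (suc n C suc k)) (ℕ.*-comm p (p ^ a))
        (p^a∣m*n⇒p^[1+a]∣p^j*n a a (subst (suc k <_) (sym eq) k<N)
          (divides (n C k) (begin
            suc k * (suc n C suc k) ≡⟨ [1+k]*[1+n]C[1+k]≡[1+n]*nCk n k ⟩
            suc n * (n C k)         ≡⟨ ℕ.*-comm (suc n) (n C k) ⟩
            (n C k) * suc n         ≡⟨ cong ((n C k) *_) eq ⟨
            (n C k) * p ^ a         ∎))))

    -- Reflects (1+X)^(m+p^a) ≡ (1+X)^m (1+X^(p^a)) modulo p, whose coefficients below degree p^a
    -- are those of (1+X)^m. Pascal's rule carries the base case m = 0 upwards.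
    [p^a+m]Ck≡mCk : ∀ a m {k} → k < p ^ a → ∃[ e ] (m + p ^ a) C k ≡ m C k + e * p
    [p^a+m]Ck≡mCk a m       {zero}  _   = 0 , refl
    [p^a+m]Ck≡mCk a zero    {suc k} k<N = quotient p∣c , _∣_.equality p∣c
      where p∣c = p∣p^aCk a k k<N
    [p^a+m]Ck≡mCk a (suc m) {suc k} k<N
      with e , eq ← [p^a+m]Ck≡mCk a m {k} (ℕ.<-trans (ℕ.n<1+n k) k<N)
      with f , eq′ ← [p^a+m]Ck≡mCk a m {suc k} k<N = e + f , (begin
        suc (m + p ^ a) C suc k                    ≡⟨ pascal (m + p ^ a) k ⟩
        (m + p ^ a) C k + (m + p ^ a) C suc k      ≡⟨ cong₂ _+_ eq eq′ ⟩
        m C k + e * p + (m C suc k + f * p)        ≡⟨ lemma (m C k) (m C suc k) e f p ⟩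
        m C k + m C suc k + (e + f) * p            ≡⟨ cong (_+ (e + f) * p) (pascal m k) ⟨
        suc m C suc k + (e + f) * p                ∎)
      where
      lemma : ∀ u v e f p → u + e * p + (v + f * p) ≡ u + v + (e + f) * p
      lemma = ℕ-Solver.solve-∀

    -- By symmetry the coefficient is C(n+p^a,n); since n < p^a it reduces to C(n,n).
    [1+2n]C[1+n]≡1 : ∀ a {n} → p ^ a ≡ suc n → ∃[ e ] suc (2 * n) C suc n ≡ 1 + e * p
    [1+2n]C[1+n]≡1 a {n} eq
      with e , eq′ ← [p^a+m]Ck≡mCk a n (subst (n <_) (sym eq) (ℕ.n<1+n n)) = e , (begin
        suc (2 * n) C suc n      ≡⟨ [1+2n]Cn≡[1+2n]C[1+n] n ⟨
        suc (2 * n) C n          ≡⟨ cong (_C n) (lemma n) ⟩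
        (n + suc n) C n          ≡⟨ cong (λ N → (n + N) C n) eq ⟨
        (n + p ^ a) C n          ≡⟨ eq′ ⟩
        n C n + e * p            ≡⟨ cong (_+ e * p) (nCn≡1 n) ⟩
        1 + e * p                ∎)
      where
      lemma : ∀ n → suc (2 * n) ≡ n + suc n
      lemma = ℕ-Solver.solve-∀

-- Integer congruences, the binomial theorem, and the expansion of the sum in powers of -D.

module _ where
  open Data.Integer.Base using (_+_; _*_; _-_)
  open ℤ∣ using () renaming (_∣_ to _∣ᶻ_)
  open ≡-Reasoning

  ∣-∑ : ∀ {d} n (f : Fin n → ℤ) → (∀ i → d ∣ᶻ f i) → d ∣ᶻ ∑[ i < n ] f i
  ∣-∑ zero    f d∣f = ℤ∣.divides (+ 0) refl
  ∣-∑ (suc n) f d∣f = ℤ∣.∣m∣n⇒∣m+n (d∣f Fin.zero) (∣-∑ n (λ i → f (Fin.suc i)) (λ i → d∣f (Fin.suc i)))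

  ^-distribʳ-* : ∀ x y n → (x * y) ℤ.^ n ≡ x ℤ.^ n * y ℤ.^ n
  ^-distribʳ-* x y zero    = refl
  ^-distribʳ-* x y (suc n) = trans (cong (x * y *_) (^-distribʳ-* x y n))
                                   (lemma x y (x ℤ.^ n) (y ℤ.^ n))
    where
    lemma : ∀ x y u v → x * y * (u * v) ≡ x * u * (y * v)
    lemma = ℤ-Solver.solve-∀

  pos-^ : ∀ m n → + (m ^ n) ≡ (+ m) ℤ.^ n
  pos-^ m zero    = refl
  pos-^ m (suc n) = trans (ℤ.pos-* m (m ^ n)) (cong (+ m *_) (pos-^ m n))

  ^-cong-mod : ∀ {x y m} n → x ≡ y [mod m ] → x ℤ.^ n ≡ y ℤ.^ n [mod m ]
  ^-cong-mod zero    _ = ℤ∣.divides (+ 0) refl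
  ^-cong-mod {x} {y} {m} (suc n) x≡y = subst (m ∣ᶻ_) (lemma x y (x ℤ.^ n) (y ℤ.^ n))
    (ℤ∣.∣m∣n⇒∣m+n (ℤ∣.∣n⇒∣m*n x (^-cong-mod n x≡y)) (ℤ∣.∣m⇒∣m*n (y ℤ.^ n) x≡y))
    where
    lemma : ∀ x y u v → x * (u - v) + (x - y) * v ≡ x * u - y * v
    lemma = ℤ-Solver.solve-∀

  trans-mod : ∀ {x y z m} → x ≡ y [mod m ] → y ≡ z [mod m ] → x ≡ z [mod m ]
  trans-mod {x} {y} {z} {m} x≡y y≡z = subst (m ∣ᶻ_) (lemma x y z) (ℤ∣.∣m∣n⇒∣m+n x≡y y≡z)
    where
    lemma : ∀ x y z → (x - y) + (y - z) ≡ x - z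
    lemma = ℤ-Solver.solve-∀

  -- Iterates Fermat's congruence through x^(p^(a+1)) = (x^p)^(p^a). The congruence itself is a
  -- hypothesis, discharged numerically for x = 4 and p = 3, 7.
  x^p≡x⇒x^[p^a]≡x : ∀ {x p} → x ℤ.^ p ≡ x [mod + p ] → ∀ a → x ℤ.^ (p ^ a) ≡ x [mod + p ]
  x^p≡x⇒x^[p^a]≡x {x} {p} _ zero =
    ℤ∣.divides (+ 0) (trans (cong (_- x) (ℤ.*-identityʳ x)) (ℤ.+-inverseʳ x))
  x^p≡x⇒x^[p^a]≡x {x} {p} x^p≡x (suc a) = trans-mod {x ℤ.^ (p ^ suc a)} {x ℤ.^ (p ^ a)}
    (subst (λ u → u ≡ x ℤ.^ (p ^ a) [mod + p ]) (ℤ.^-*-assoc x p (p ^ a)) (^-cong-mod (p ^ a) x^p≡x))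
    (x^p≡x⇒x^[p^a]≡x x^p≡x a)

  -- The binomial theorem padded with zero terms up to any `n` above `k`, so that expansions for
  -- different `k` share one index range.
  [1+y]^k≡∑ : ∀ y k {n} → k < n → (+ 1 + y) ℤ.^ k ≡ ∑[ j < n ] (y ℤ.^ toℕ j * + (k C toℕ j))
  [1+y]^k≡∑ y zero {suc n} _ = sym (begin
    + 1 + ∑[ j < n ] (y ℤ.^ suc (toℕ j) * + 0)
      ≡⟨ cong (λ u → + 1 + u) (sum-cong-≗ {n} (λ j → ℤ.*-zeroʳ (y ℤ.^ suc (toℕ j)))) ⟩
    + 1 + ∑[ j < n ] (+ 0)
      ≡⟨ cong (λ u → + 1 + u) (sum-replicate-zero n) ⟩
    + 1 ∎)
  [1+y]^k≡∑ y (suc k) {suc n} (s≤s k<n) = begin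
    (+ 1 + y) * (+ 1 + y) ℤ.^ k
      ≡⟨ split y ((+ 1 + y) ℤ.^ k) ⟩
    (+ 1 + y) ℤ.^ k + y * (+ 1 + y) ℤ.^ k
      -- The two copies are expanded to different lengths: multiplication by y shifts the shorter
      -- one by a degree, aligning it with the longer one after its constant term.
      ≡⟨ cong₂ (λ u v → u + y * v) ([1+y]^k≡∑ y k {suc n} (ℕ.m<n⇒m<1+n k<n)) ([1+y]^k≡∑ y k k<n) ⟩
    (+ 1 + ∑[ j < n ] g j) + y * ∑[ j < n ] f j
      ≡⟨ ℤ.+-assoc (+ 1) (∑[ j < n ] g j) _ ⟩
    + 1 + (∑[ j < n ] g j + y * ∑[ j < n ] f j)
      ≡⟨ cong (λ u → + 1 + (∑[ j < n ] g j + u)) (*-distribˡ-sum {n} y f) ⟩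
    + 1 + (∑[ j < n ] g j + ∑[ j < n ] (y * f j))
      ≡⟨ cong (λ u → + 1 + u) (∑-distrib-+ {n} g (λ j → y * f j)) ⟨
    + 1 + ∑[ j < n ] (g j + y * f j)
      ≡⟨ cong (λ u → + 1 + u) (sum-cong-≗ {n} merge) ⟩
    + 1 + ∑[ j < n ] (y ℤ.^ suc (toℕ j) * + (suc k C suc (toℕ j))) ∎
    where
    f g : Fin n → ℤ
    f j = y ℤ.^ toℕ j * + (k C toℕ j)
    g j = y ℤ.^ suc (toℕ j) * + (k C suc (toℕ j))
    split : ∀ y u → (+ 1 + y) * u ≡ u + y * u
    split = ℤ-Solver.solve-∀
    factor : ∀ y u c c′ → y * u * c′ + y * (u * c) ≡ y * u * (c + c′)
    factor = ℤ-Solver.solve-∀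
    merge : ∀ j → g j + y * f j ≡ y ℤ.^ suc (toℕ j) * + (suc k C suc (toℕ j))
    merge j = trans (factor y (y ℤ.^ toℕ j) (+ (k C toℕ j)) (+ (k C suc (toℕ j))))
                    (cong (λ u → y ℤ.^ suc (toℕ j) * + u) (sym (pascal k (toℕ j))))

  centralBinomialSum-suc : ∀ x n →
    centralBinomialSum x (suc n) ≡ centralBinomialSum x n + x ℤ.^ n * + ((2 ℕ.* n) C n)
  centralBinomialSum-suc x n = begin
    ∑[ k < suc n ] t (toℕ k)
      ≡⟨ sum-init-last {n} (λ k → t (toℕ k)) ⟩
    ∑[ k < n ] t (toℕ (inject₁ k)) + t (toℕ (fromℕ n))
      ≡⟨ cong₂ _+_ (sum-cong-≗ {n} (λ k → cong t (toℕ-inject₁ k))) (cong t (toℕ-fromℕ n)) ⟩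
    ∑[ k < n ] t (toℕ k) + t n ∎
    where
    t : ℕ → ℤ
    t k = x ℤ.^ k * + ((2 ℕ.* k) C k)

  -- Here y = -D. An extra factor 4 on both sides avoids the exponent n-1, and a bound `m`
  -- independent of `n` keeps the index range fixed during the induction; terms with j ≥ n are zero.
  4^n*centralBinomialSum≡∑ : ∀ {x y} → + 4 * x ≡ + 1 + y → ∀ n {m} → n ≤ m →
    (+ 4) ℤ.^ n * centralBinomialSum x n ≡ ∑[ j < m ] (y ℤ.^ toℕ j * (+ 4 * + scaledSum (toℕ j) n))
  4^n*centralBinomialSum≡∑ {x} {y} _ zero {m} _ = sym (begin
    ∑[ j < m ] (y ℤ.^ toℕ j * + 0) ≡⟨ sum-cong-≗ {m} (λ j → ℤ.*-zeroʳ (y ℤ.^ toℕ j)) ⟩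
    ∑[ j < m ] (+ 0)                 ≡⟨ sum-replicate-zero m ⟩
    + 0                            ∎)
  4^n*centralBinomialSum≡∑ {x} {y} 4x≡1+y (suc n) {m} n<m = begin
    + 4 * (+ 4) ℤ.^ n * centralBinomialSum x (suc n)
      ≡⟨ cong (+ 4 * (+ 4) ℤ.^ n *_) (centralBinomialSum-suc x n) ⟩
    + 4 * (+ 4) ℤ.^ n * (centralBinomialSum x n + x ℤ.^ n * b)
      ≡⟨ expand ((+ 4) ℤ.^ n) (centralBinomialSum x n) (x ℤ.^ n) b ⟩
    + 4 * ((+ 4) ℤ.^ n * centralBinomialSum x n) + + 4 * b * ((+ 4) ℤ.^ n * x ℤ.^ n)
      ≡⟨ cong₂ (λ u v → + 4 * u + + 4 * b * v) (4^n*centralBinomialSum≡∑ 4x≡1+y n (ℕ.<⇒≤ n<m)) newton ⟩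
    + 4 * ∑[ j < m ] f j + + 4 * b * ∑[ j < m ] g j
      ≡⟨ cong₂ _+_ (*-distribˡ-sum {m} (+ 4) f) (*-distribˡ-sum {m} (+ 4 * b) g) ⟩
    ∑[ j < m ] (+ 4 * f j) + ∑[ j < m ] (+ 4 * b * g j)
      ≡⟨ ∑-distrib-+ {m} (λ j → + 4 * f j) (λ j → + 4 * b * g j) ⟨
    ∑[ j < m ] (+ 4 * f j + + 4 * b * g j)
      ≡⟨ sum-cong-≗ {m} merge ⟩
    ∑[ j < m ] (y ℤ.^ toℕ j * (+ 4 * + scaledSum (toℕ j) (suc n))) ∎
    where
    b : ℤ
    b = + ((2 ℕ.* n) C n)
    f g : Fin m → ℤ
    f j = y ℤ.^ toℕ j * (+ 4 * + scaledSum (toℕ j) n)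
    g j = y ℤ.^ toℕ j * + (n C toℕ j)
    expand : ∀ q s u b → + 4 * q * (s + u * b) ≡ + 4 * (q * s) + + 4 * b * (q * u)
    expand = ℤ-Solver.solve-∀
    newton : (+ 4) ℤ.^ n * x ℤ.^ n ≡ ∑[ j < m ] g j
    newton = begin
      (+ 4) ℤ.^ n * x ℤ.^ n ≡⟨ ^-distribʳ-* (+ 4) x n ⟨
      (+ 4 * x) ℤ.^ n       ≡⟨ cong (ℤ._^ n) 4x≡1+y ⟩
      (+ 1 + y) ℤ.^ n       ≡⟨ [1+y]^k≡∑ y n n<m ⟩
      ∑[ j < m ] g j        ∎
    collect : ∀ u t c b → + 4 * (u * (+ 4 * t)) + + 4 * b * (u * c) ≡ u * (+ 4 * (+ 4 * t + c * b))
    collect = ℤ-Solver.solve-∀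
    merge : ∀ j → + 4 * f j + + 4 * b * g j ≡ y ℤ.^ toℕ j * (+ 4 * + scaledSum (toℕ j) (suc n))
    merge j = trans (collect (y ℤ.^ toℕ j) (+ scaledSum (toℕ j) n) (+ (n C toℕ j)) b)
      (cong (λ u → y ℤ.^ toℕ j * (+ 4 * u)) (sym (cong₂ _+_
        (ℤ.pos-* 4 (scaledSum (toℕ j) n)) (ℤ.pos-* (n C toℕ j) ((2 ℕ.* n) C n)))))

  -- The congruence modulo p^(a+1) for sums of length p^a.

  module _ {p} (p-prime : Prime p) (2<p : 2 < p) where
    private instance
      p≢0 : NonZero p
      p≢0 = prime⇒nonZero p-prime

    -- The closed form makes p^a divide (2j+1) T_j, and 2j+1 < 3^j ≤ p^j, so the valuation lemma
    -- applies.
    p^[1+a]∣p^j*scaledSum : ∀ a {n} → p ^ a ≡ suc n → ∀ i →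
      p ^ suc a ∣ p ^ (2 ℕ.+ i) ℕ.* scaledSum (2 ℕ.+ i) (suc n)
    p^[1+a]∣p^j*scaledSum a {n} N≡1+n i =
      p^a∣m*n⇒p^[1+a]∣p^j*n p-prime a j (ℕ.<-≤-trans (1+2j<3^j i) (ℕ.^-monoˡ-≤ j 2<p))
        (subst₂ _∣_ (sym N≡1+n) (sym ([1+2j]*scaledSum j n))
          (∣-trans (m∣m*n (suc (2 ℕ.* n) C suc n)) (m∣m*n (n C j))))
      where j = 2 ℕ.+ i

    centralBinomialSum-mod-pred : ∀ {x z} → + 4 * x ≡ + 1 + + 3 * z → + p ∣ᶻ + 3 * z →
      (+ 4) ℤ.^ p ≡ + 4 [mod + p ] → ∀ b {n} → p ^ suc b ≡ suc n →
      centralBinomialSum x (suc n) ≡ + suc n * (+ 1 - z) [mod + (p ^ suc (suc b)) ]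
    centralBinomialSum-mod-pred {x} {z} 4x≡1+3z (ℤ∣.divides w 3z≡wp) 4^p≡4 b {n} N≡1+n
      with ℤ∣.divides f 4^N-4≡fp ← x^p≡x⇒x^[p^a]≡x 4^p≡4 (suc b)
      with e , c≡1+ep ← [1+2n]C[1+n]≡1 p-prime (suc b) N≡1+n = ℤ∣.∣ᵤ⇒∣
      -- It suffices to treat 4^N times the difference `Δ`, because p does not divide 4^N.
      (prime-power-cancelˡ-∣ p-prime (suc (suc b)) p∤4^N
        (subst (p ^ suc (suc b) ∣_) (ℤ.abs-* (+ (4 ^ suc n)) Δ) (ℤ∣.∣⇒∣ᵤ p^[1+a]∣4^N*Δ)))
      where
      a = suc b
      y = + 3 * z
      N = + suc n
      Δ = centralBinomialSum x (suc n) - N * (+ 1 - z)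

      t₀ t₁ c : ℤ
      t₀ = + scaledSum 0 (suc n)
      t₁ = + scaledSum 1 (suc n)
      c  = + (suc (2 ℕ.* n) C suc n)

      tail : Fin (suc n) → ℤ
      tail i = y ℤ.^ (2 ℕ.+ toℕ i) * (+ 4 * + scaledSum (2 ℕ.+ toℕ i) (suc n))

      p^[1+a]∣tail : ∀ i → + (p ^ suc a) ∣ᶻ tail i
      p^[1+a]∣tail i = subst (+ (p ^ suc a) ∣ᶻ_) (sym (begin
        y ℤ.^ j * (+ 4 * t)
          ≡⟨ cong (λ u → u ℤ.^ j * (+ 4 * t)) 3z≡wp ⟩
        (w * + p) ℤ.^ j * (+ 4 * t)
          ≡⟨ cong (_* (+ 4 * t)) (^-distribʳ-* w (+ p) j) ⟩
        w ℤ.^ j * (+ p) ℤ.^ j * (+ 4 * t)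
          ≡⟨ lemma (w ℤ.^ j) ((+ p) ℤ.^ j) t ⟩
        + 4 * w ℤ.^ j * ((+ p) ℤ.^ j * t)
          ≡⟨ cong (λ u → + 4 * w ℤ.^ j * (u * t)) (pos-^ p j) ⟨
        + 4 * w ℤ.^ j * (+ (p ^ j) * t)
          ≡⟨ cong (+ 4 * w ℤ.^ j *_) (ℤ.pos-* (p ^ j) (scaledSum j (suc n))) ⟨
        + 4 * w ℤ.^ j * + (p ^ j ℕ.* scaledSum j (suc n)) ∎))
        (ℤ∣.∣n⇒∣m*n (+ 4 * w ℤ.^ j) (ℤ∣.∣ᵤ⇒∣ (p^[1+a]∣p^j*scaledSum a N≡1+n (toℕ i))))
        where
        j = 2 ℕ.+ toℕ i
        t = + scaledSum j (suc n)
        lemma : ∀ u v t → u * v * (+ 4 * t) ≡ + 4 * u * (v * t)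
        lemma = ℤ-Solver.solve-∀

      N≡p^b*p : N ≡ + (p ^ b) * + p
      N≡p^b*p = begin
        + suc n                      ≡⟨ cong +_ N≡1+n ⟨
        + (p ℕ.* p ^ b)  ≡⟨ cong +_ (ℕ.*-comm p (p ^ b)) ⟩
        + (p ^ b ℕ.* p)  ≡⟨ ℤ.pos-* (p ^ b) p ⟩
        + (p ^ b) * + p              ∎

      c≡1+e*p : c ≡ + 1 + + e * + p
      c≡1+e*p = trans (cong +_ c≡1+ep) (cong (λ u → + 1 + u) (ℤ.pos-* e p))

      p^[1+a]≡p*N : + (p ^ suc a) ≡ + p * N
      p^[1+a]≡p*N = trans (cong (λ u → + (p ℕ.* u)) N≡1+n) (ℤ.pos-* p (suc n))

      t₀≡N*c : t₀ ≡ N * c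
      t₀≡N*c = begin
        t₀                                        ≡⟨ cong +_ (ℕ.*-identityˡ (scaledSum 0 (suc n))) ⟨
        + (1 ℕ.* scaledSum 0 (suc n)) ≡⟨ cong +_ ([1+2j]*scaledSum 0 n) ⟩
        + (suc n ℕ.* d ℕ.* 1) ≡⟨ cong +_ (ℕ.*-identityʳ _) ⟩
        + (suc n ℕ.* d)               ≡⟨ ℤ.pos-* (suc n) d ⟩
        N * c                                     ∎
        where d = suc (2 ℕ.* n) C suc n

      3*t₁≡N*c*[N-1] : + 3 * t₁ ≡ N * c * (+ (p ^ b) * + p - + 1)
      3*t₁≡N*c*[N-1] = begin
        + 3 * t₁
          ≡⟨ ℤ.pos-* 3 (scaledSum 1 (suc n)) ⟨
        + (3 ℕ.* scaledSum 1 (suc n))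
          ≡⟨ cong +_ ([1+2j]*scaledSum 1 n) ⟩
        + (suc n ℕ.* d ℕ.* (n C 1))
          ≡⟨ ℤ.pos-* (suc n ℕ.* d) (n C 1) ⟩
        + (suc n ℕ.* d) * + (n C 1)
          ≡⟨ cong₂ _*_ (ℤ.pos-* (suc n) d) (cong +_ (nC1≡n n)) ⟩
        N * c * (N - + 1)
          -- Only this occurrence of N is rewritten: it shows N-1 ≡ -1 modulo p, while the leading N
          -- is kept to form p N = p^(a+1).
          ≡⟨ cong (λ u → N * c * (u - + 1)) N≡p^b*p ⟩
        N * c * (+ (p ^ b) * + p - + 1) ∎
        where d = suc (2 ℕ.* n) C suc n

      4^N≡4+f*p : + (4 ^ suc n) ≡ + 4 + f * + p
      4^N≡4+f*p = begin
        + (4 ^ suc n)                                    ≡⟨ pos-^ 4 (suc n) ⟩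
        (+ 4) ℤ.^ suc n                                  ≡⟨ cong ((+ 4) ℤ.^_) N≡1+n ⟨
        (+ 4) ℤ.^ (p ^ suc b)                            ≡⟨ lemma ((+ 4) ℤ.^ (p ^ suc b)) ⟩
        + 4 + ((+ 4) ℤ.^ (p ^ suc b) - + 4)              ≡⟨ cong (λ u → + 4 + u) 4^N-4≡fp ⟩
        + 4 + f * + p                                    ∎
        where
        lemma : ∀ u → u ≡ + 4 + (u - + 4)
        lemma = ℤ-Solver.solve-∀

      p∤2 : ¬ p ∣ 2
      p∤2 p∣2 = ℕ.<⇒≱ 2<p (∣⇒≤ p∣2)

      p∤4^N : ¬ p ∣ 4 ^ suc n
      -- Since 4^N = 4 + f p, a prime p dividing 4^N would divide 2 * 2.
      p∤4^N p∣4^N = Sum.[ p∤2 , p∤2 ] (euclidsLemma 2 2 p-prime (ℤ∣.∣⇒∣ᵤ {+ p} {+ 4}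
        (ℤ∣.∣m+n∣n⇒∣m (subst (+ p ∣ᶻ_) 4^N≡4+f*p (ℤ∣.∣ᵤ⇒∣ {+ p} {+ (4 ^ suc n)} p∣4^N))
                       (ℤ∣.∣n⇒∣m*n f ℤ∣.∣-refl))))

      -- With c = 1 + e p, N = p^b p and 4^N = 4 + f p, the part free of p, 4N - 4zN - 4N(1-z),
      -- cancels; `q` is the remaining coefficient of p N.
      q : ℤ
      q = + 4 * (z * + (p ^ b) + + e * (+ 1 - z + z * (+ (p ^ b) * + p))) - f * (+ 1 - z)

      4^N*Δ≡ : + (4 ^ suc n) * Δ ≡ q * + (p ^ suc a) + ∑[ i < suc n ] tail i
      4^N*Δ≡ = begin
        + (4 ^ suc n) * Δ
          ≡⟨ expand (+ (4 ^ suc n)) (centralBinomialSum x (suc n)) (N * (+ 1 - z)) ⟩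
        + (4 ^ suc n) * centralBinomialSum x (suc n) - + (4 ^ suc n) * M
          ≡⟨ cong₂ (λ u v → u * centralBinomialSum x (suc n) - v * M)
               (pos-^ 4 (suc n)) 4^N≡4+f*p ⟩
        (+ 4) ℤ.^ suc n * centralBinomialSum x (suc n) - R
          -- Length 3+n rather than 1+n lets the terms j = 0, 1 split off by computation, leaving
          -- `suc n` tail terms.
          ≡⟨ cong (_- R)
               (4^n*centralBinomialSum≡∑ {y = y} 4x≡1+3z (suc n) {3 ℕ.+ n} (ℕ.m≤n+m (suc n) 2)) ⟩
        + 1 * (+ 4 * t₀) + (+ 3 * z * + 1 * (+ 4 * t₁) + T) - R
          -- The 3 in y = 3z is moved onto `t₁`, where it is exactly the factor 2j+1 of the closed
          -- form; no division by 3 occurs, even for p = 3.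
          ≡⟨ collect t₀ t₁ T (+ p) N z f ⟩
        + 4 * t₀ + + 4 * z * (+ 3 * t₁) - R + T
          ≡⟨ cong₂ (λ u v → + 4 * u + + 4 * z * v - R + T)
               t₀≡N*c 3*t₁≡N*c*[N-1] ⟩
        + 4 * (N * c) + + 4 * z * (N * c * (+ (p ^ b) * + p - + 1)) - R + T
          ≡⟨ cong (λ u → + 4 * (N * u) + + 4 * z * (N * u * (+ (p ^ b) * + p - + 1)) - R + T)
               c≡1+e*p ⟩
        + 4 * (N * (+ 1 + + e * + p)) + + 4 * z * (N * (+ 1 + + e * + p) * (+ (p ^ b) * + p - + 1)) - R + T
          ≡⟨ factor N (+ p) (+ (p ^ b)) (+ e) f z T ⟩
        q * (+ p * N) + T
          ≡⟨ cong (λ u → q * u + T) p^[1+a]≡p*N ⟨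
        q * + (p ^ suc a) + T ∎
        where
        T M R : ℤ
        T = ∑[ i < suc n ] tail i
        M = N * (+ 1 - z)
        R = (+ 4 + f * + p) * M
        expand : ∀ u s v → u * (s - v) ≡ u * s - u * v
        expand = ℤ-Solver.solve-∀
        collect : ∀ t₀ t₁ T p N z f →
          + 1 * (+ 4 * t₀) + (+ 3 * z * + 1 * (+ 4 * t₁) + T) - (+ 4 + f * p) * (N * (+ 1 - z))
          ≡ + 4 * t₀ + + 4 * z * (+ 3 * t₁) - (+ 4 + f * p) * (N * (+ 1 - z)) + T
        collect = ℤ-Solver.solve-∀
        factor : ∀ N p r e f z T →
          + 4 * (N * (+ 1 + e * p)) + + 4 * z * (N * (+ 1 + e * p) * (r * p - + 1))
            - (+ 4 + f * p) * (N * (+ 1 - z)) + T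
          ≡ (+ 4 * (z * r + e * (+ 1 - z + z * (r * p))) - f * (+ 1 - z)) * (p * N) + T
        factor = ℤ-Solver.solve-∀

      p^[1+a]∣4^N*Δ : + (p ^ suc a) ∣ᶻ + (4 ^ suc n) * Δ
      p^[1+a]∣4^N*Δ = subst (+ (p ^ suc a) ∣ᶻ_) (sym 4^N*Δ≡)
        (ℤ∣.∣m∣n⇒∣m+n (ℤ∣.∣n⇒∣m*n q ℤ∣.∣-refl) (∣-∑ (suc n) tail p^[1+a]∣tail))

    centralBinomialSum-mod : ∀ x z → + 4 * x ≡ + 1 + + 3 * z → + p ∣ᶻ + 3 * z →
      (+ 4) ℤ.^ p ≡ + 4 [mod + p ] → ∀ b →
      centralBinomialSum x (p ^ suc b) ≡ + (p ^ suc b) * (+ 1 - z) [mod + (p ^ suc (suc b)) ]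
    centralBinomialSum-mod x z 4x≡1+3z p∣3z 4^p≡4 b =
      subst (λ N → centralBinomialSum x N ≡ + N * (+ 1 - z) [mod + (p ^ suc (suc b)) ])
        (ℕ.suc-pred (p ^ suc b))
        (centralBinomialSum-mod-pred {x} {z} 4x≡1+3z p∣3z 4^p≡4 b (sym (ℕ.suc-pred (p ^ suc b))))
      where instance _ = ℕ.m^n≢0 p (suc b)

  -- The factor p^a is already present, so the cofactor 1-z matters only modulo p.
  change-unit-mod : ∀ p a s u v → + p ∣ᶻ u - v →
    s ≡ + (p ^ a) * u [mod + (p ^ suc a) ] → s ≡ + (p ^ a) * v [mod + (p ^ suc a) ]
  change-unit-mod p a s u v p∣u-v s≡N*u = trans-mod {s} {+ (p ^ a) * u} s≡N*u
    (subst₂ _∣ᶻ_ (trans (ℤ.*-comm (+ (p ^ a)) (+ p)) (sym (ℤ.pos-* p (p ^ a))))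
      (lemma (+ (p ^ a)) u v) (ℤ∣.*-monoʳ-∣ (+ (p ^ a)) p∣u-v))
    where
    lemma : ∀ N u v → N * (u - v) ≡ N * u - N * v
    lemma = ℤ-Solver.solve-∀

-- Specialization to the primes 3 and 7.

corollary1p4 : (a : ℕ) → .{{NonZero a}} →
    (centralBinomialSum (- (+ 2)) (3 ^ a) ≡ + (3 ^ a) [mod + (3 ^ suc a) ])
    × (centralBinomialSum (- (+ 5)) (3 ^ a) ≡ - (+ (3 ^ a)) [mod + (3 ^ suc a) ])
    × (centralBinomialSum (- (+ 5)) (7 ^ a) ≡ + (7 ^ a) [mod + (7 ^ suc a) ])
corollary1p4 (suc b) =
    subst (λ r → centralBinomialSum (- (+ 2)) (3 ^ suc b) ≡ r [mod + (3 ^ suc (suc b)) ])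
      (ℤ.*-identityʳ (+ (3 ^ suc b)))
      -- z = -3 since 4(-2) = 1 + 3(-3); thus 1-z = 4, and 4 - 1 = 1 * 3.
      (change-unit-mod 3 (suc b) (centralBinomialSum (- (+ 2)) (3 ^ suc b)) (+ 4) (+ 1) (ℤ∣.divides (+ 1) refl)
        (centralBinomialSum-mod prime[3] 2<3 (- (+ 2)) (- (+ 3)) refl (ℤ∣.divides (- (+ 3)) refl) 4^3≡4 b))
  , subst (λ r → centralBinomialSum (- (+ 5)) (3 ^ suc b) ≡ r [mod + (3 ^ suc (suc b)) ])
      (trans (ℤ.*-comm (+ (3 ^ suc b)) (- (+ 1))) (ℤ.-1*i≡-i (+ (3 ^ suc b))))
      -- z = -7 since 4(-5) = 1 + 3(-7); thus 1-z = 8, and 8 + 1 = 3 * 3. For p = 7 the same 8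
      -- reduces to 1.
      (change-unit-mod 3 (suc b) (centralBinomialSum (- (+ 5)) (3 ^ suc b)) (+ 8) (- (+ 1)) (ℤ∣.divides (+ 3) refl)
        (centralBinomialSum-mod prime[3] 2<3 (- (+ 5)) (- (+ 7)) refl (ℤ∣.divides (- (+ 7)) refl) 4^3≡4 b))
  , subst (λ r → centralBinomialSum (- (+ 5)) (7 ^ suc b) ≡ r [mod + (7 ^ suc (suc b)) ])
      (ℤ.*-identityʳ (+ (7 ^ suc b)))
      (change-unit-mod 7 (suc b) (centralBinomialSum (- (+ 5)) (7 ^ suc b)) (+ 8) (+ 1) (ℤ∣.divides (+ 1) refl)
        (centralBinomialSum-mod (from-yes (prime? 7)) (from-yes (2 ℕ.<? 7)) (- (+ 5)) (- (+ 7)) refl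
          -- The witnesses are -21 = -3 * 7 and 4^7 - 4 = 16380 = 2340 * 7.
          (ℤ∣.divides (- (+ 3)) refl) (ℤ∣.divides (+ 2340) refl) b))
  where
  prime[3] : Prime 3
  prime[3] = from-yes (prime? 3)
  2<3 : 2 < 3
  2<3 = ℕ.≤-refl
  4^3≡4 : (+ 4) ℤ.^ 3 ≡ + 4 [mod + 3 ]
  4^3≡4 = ℤ∣.divides (+ 20) refl
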